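{- Let $G$ be a finite simple graph that has a minimum identifying code $I$ (that is, an identifying code with $|I| = \gamma^{\rm ID}(G)$) such that the induced subgraph $G[I]$ has no isolated vertices. Then $\gamma^{\rm ID}(G\Box K_2) \le 2\gamma^{\rm ID}(G)$.
   Context: All graphs are finite, simple and undirected. For a vertex $x$ of a graph $G$, $N[x]$ denotes the closed neighborhood ($x$ together with all its neighbors). A set $D\subseteq V(G)$ is a dominating set if $N[x]\cap D\neq\emptyset$ for every vertex $x$. An identifying code (ID code) of $G$ is a dominating set $C$ of $G$ such that $N[x]\cap C\neq N[y]\cap C$ for every two distinct vertices $x,y$ of $G$. $\gamma^{\rm ID}(G)$ denotes the minimum cardinality of an ID code of $G$. $G\Box H$ denotes the Cartesian product of graphs. -}

module Defs where

open import Data.Fin using (Fin; _≟_; remQuot)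
open import Data.Fin.Subset using (Subset; _∈_; _∩_; ∣_∣; Nonempty)
open import Data.Nat using (ℕ; _*_; _≤_)
open import Data.Product using (∃; _×_; _,_; proj₁)
open import Data.Sum using (_⊎_; inj₁; inj₂)
open import Data.Vec using (tabulate)
open import Level using (0ℓ)
open import Relation.Binary using (Rel; Symmetric; Irreflexive; Decidable)
open import Relation.Binary.PropositionalEquality
  using (_≡_; _≢_; refl; sym; ≢-sym)
open import Relation.Nullary using (¬_; does)
open import Relation.Nullary.Decidable using (_×-dec_; _⊎-dec_; ¬?)

private
  variable
    V W : Set
    m n : ℕ

-- Simple undirected graphs; a finite graph is a Graph (Fin n).  Decidability
-- of adjacency is automatic classically, and lets closed neighbourhoods be
-- elements of Subset n.
record Graph (V : Set) : Set₁ where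
  infix 4 _~_ _~?_
  field
    _~_    : Rel V 0ℓ
    ~-sym  : Symmetric _~_
    ~-irr  : Irreflexive _≡_ _~_
    _~?_   : Decidable _~_

open Graph

pullback : (W → V) → Graph V → Graph W
pullback f G = record
  { _~_   = λ x y → _~_ G (f x) (f y)
  ; ~-sym = ~-sym G
  ; ~-irr = λ { refl → ~-irr G refl }
  ; _~?_  = λ x y → _~?_ G (f x) (f y)
  }

-- Proofs of x ∈ S are unique, so the vertices are exactly the elements of S.
_[_] : Graph (Fin n) → (S : Subset n) → Graph (∃ λ x → x ∈ S)
G [ S ] = pullback proj₁ G

Isolated : Graph V → V → Set
Isolated G x = ∀ y → ¬ _~_ G x y

NoIsolatedVertices : Graph V → Set
NoIsolatedVertices G = ∀ x → ¬ Isolated G x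

K : ∀ n → Graph (Fin n)
K n = record
  { _~_   = _≢_
  ; ~-sym = ≢-sym
  ; ~-irr = λ eq neq → neq eq
  ; _~?_  = λ x y → ¬? (x ≟ y)
  }

cartesianProduct : Graph (Fin m) → Graph (Fin n) → Graph (Fin m × Fin n)
cartesianProduct G H = record
  { _~_   = λ (x , i) (y , j) → (x ≡ y × _~_ H i j) ⊎ (_~_ G x y × i ≡ j)
  ; ~-sym = λ { (inj₁ (p , q)) → inj₁ (sym p , ~-sym H q)
              ; (inj₂ (p , q)) → inj₂ (~-sym G p , sym q) }
  ; ~-irr = λ { refl (inj₁ (_ , q)) → ~-irr H refl q
              ; refl (inj₂ (p , _)) → ~-irr G refl p }
  ; _~?_  = λ (x , i) (y , j) →
              ((x ≟ y) ×-dec _~?_ H i j) ⊎-dec (_~?_ G x y ×-dec (i ≟ j))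
  }

-- Vertices are renumbered along the bijection remQuot : Fin (m * n) → Fin m × Fin n.
infixl 7 _□_
_□_ : Graph (Fin m) → Graph (Fin n) → Graph (Fin (m * n))
_□_ {n = n} G H = pullback (remQuot n) (cartesianProduct G H)

module _ (G : Graph (Fin n)) where

  N[_] : Fin n → Subset n
  N[ x ] = tabulate λ y → does ((x ≟ y) ⊎-dec _~?_ G x y)

  IsDominating : Subset n → Set
  IsDominating D = ∀ x → Nonempty (N[ x ] ∩ D)

  IsIDCode : Subset n → Set
  IsIDCode C = IsDominating C × (∀ x y → x ≢ y → N[ x ] ∩ C ≢ N[ y ] ∩ C)

  -- Graphs with twins have no identifying code, so γ^ID is partial and is
  -- given as a relation: γ^ID(G) exists and equals k.
  γID≡ : ℕ → Set
  γID≡ k = (∃ λ C → IsIDCode C × ∣ C ∣ ≡ k) × (∀ C → IsIDCode C → k ≤ ∣ C ∣)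

{-# OPTIONS --safe #-}
-- Take the code I × V(H), which has ∣V(H)∣ · ∣I∣ elements.  In the layer of
-- (x , i) its trace on N[(x , i)] is N[x] ∩ I, while the other layers contain
-- at most the vertex x itself.  Two vertices in one layer are therefore
-- separated by I.  If (x , i) and (y , j) with i ≢ j had equal traces, then
-- N[x] ∩ I ⊆ {y} and N[y] ∩ I ⊆ {x}; since I dominates, x ≡ y would be in I and
-- isolated in G[I].
module Submission where

open import Defs
open import Data.Nat using (ℕ; _*_; _≤_)
open import Data.Fin using (Fin)
open import Data.Fin.Subset using (Subset; ∣_∣)
open import Data.Product using (∃; _×_)
open import Relation.Binary.PropositionalEquality using (_≡_)

open import Data.Bool.Properties using () renaming (_≟_ to _≟ᵇ_)
open import Data.Fin using (_≟_; combine)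
open import Data.Fin.Properties using (all?; remQuot-combine; combine-injectiveˡ; combine-surjective)
open import Data.Fin.Subset using (_∈_; _⊆_; _∩_; inside; outside)
open import Data.Fin.Subset.Properties
  using (anySubset?; nonempty?; x∈p∩q⁺; x∈p∩q⁻; ⊆-antisym)
open import Data.Nat using (zero; suc; _+_; _<_; _<?_)
open import Data.Nat.Induction using (<-rec)
open import Data.Nat.Properties using (*-comm; ≤-trans; ≤-reflexive; ≮⇒≥)
open import Data.Product using (_,_; proj₁; proj₂)
open import Data.Sum using (_⊎_; inj₁; inj₂)
open import Data.Vec using (_∷_; []; _++_; concat; lookup; map; replicate)
open import Data.Vec.Properties
  using (≡-dec; lookup-concat; lookup-map; lookup-replicate; lookup∘tabulate;
         lookup⇒[]=; []=⇒lookup)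
open import Relation.Binary.PropositionalEquality
  using (_≢_; refl; sym; trans; cong; subst; subst₂)
open import Relation.Nullary using (Dec; does; yes; no; contradiction)
open import Relation.Nullary.Decidable
  using (_×-dec_; _⊎-dec_; _→-dec_; ¬?; dec-true; decidable-stable)
open import Relation.Unary using (Pred; Decidable)
open import Level using (0ℓ)

open Graph

private
  variable
    m n : ℕ

  does-true : ∀ {A : Set} (a? : Dec A) → does a? ≡ inside → A
  does-true (yes a) _ = a

module _ (G : Graph (Fin n)) where

  ∈N⁺ : ∀ {x y} → x ≡ y ⊎ _~_ G x y → y ∈ N[_] G x
  ∈N⁺ {x} {y} p = lookup⇒[]= y _
    (trans (lookup∘tabulate _ y) (dec-true ((x ≟ y) ⊎-dec _~?_ G x y) p))

  ∈N⁻ : ∀ {x y} → y ∈ N[_] G x → x ≡ y ⊎ _~_ G x y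
  ∈N⁻ {x} {y} p = does-true ((x ≟ y) ⊎-dec _~?_ G x y)
    (trans (sym (lookup∘tabulate _ y)) ([]=⇒lookup p))

  -- Domination and separation quantify over finitely many vertices, so exhaustive checking decides
  -- them. The search for a minimum code relies on this.
  isIDCode? : Decidable (IsIDCode G)
  isIDCode? C =
    all? (λ x → nonempty? (N[_] G x ∩ C)) ×-dec
    all? (λ x → all? λ y →
      ¬? (x ≟ y) →-dec ¬? (≡-dec _≟ᵇ_ (N[_] G x ∩ C) (N[_] G y ∩ C)))

-- Strong induction on cardinality: if the search over all subsets finds a strictly smaller one
-- satisfying `P`, the argument restarts there; otherwise `C` is already minimum.
minimumSubset : {P : Pred (Subset n) 0ℓ} → Decidable P → ∀ C → P C →
  ∃ λ D → P D × (∀ E → P E → ∣ D ∣ ≤ ∣ E ∣)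
minimumSubset {P = P} P? C pC = <-rec Q step _ C pC refl
  where
  Q : ℕ → Set
  Q k = ∀ C → P C → ∣ C ∣ ≡ k → ∃ λ D → P D × (∀ E → P E → ∣ D ∣ ≤ ∣ E ∣)

  step : ∀ k → (∀ {l} → l < k → Q l) → Q k
  step _ rec C pC refl with anySubset? (λ E → P? E ×-dec (∣ E ∣ <? ∣ C ∣))
  ... | yes (E , pE , E<C) = rec E<C E pE refl
  ... | no ∄E = C , pC , λ E pE → ≮⇒≥ λ E<C → ∄E (E , pE , E<C)

-- As `γID≡` is a relation, a bound for the product must come with a proof that a minimum exists
-- there; exhibiting a single code settles both.
γID-exists : (G : Graph (Fin n)) (C : Subset n) → IsIDCode G C →
  ∃ λ k → γID≡ G k × k ≤ ∣ C ∣
γID-exists G C idC with minimumSubset (isIDCode? G) C idC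
... | D , idD , D≤ = ∣ D ∣ , ((D , idD , refl) , D≤) , D≤ C idC

-- Repeating each bit `k` times in a row follows the numbering of `combine`, where the copies of one
-- vertex are consecutive.
layers : ∀ k → Subset n → Subset (n * k)
layers k I = concat (map (replicate k) I)

lookup-layers : ∀ {k} (I : Subset n) x (i : Fin k) →
  lookup (layers k I) (combine x i) ≡ lookup I x
lookup-layers {k = k} I x i = trans (lookup-concat (map (replicate k) I) x i)
  (trans (cong (λ xs → lookup xs i) (lookup-map x (replicate k) I))
         (lookup-replicate i (lookup I x)))

∣layers∣ : ∀ k (I : Subset n) → ∣ layers k I ∣ ≡ ∣ I ∣ * k
∣layers∣ k [] = refl
∣layers∣ k (inside ∷ I) = go k
  where
  -- The length `l` of the leading block varies while the tail keeps its width `k`; induction on `k`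
  -- itself would change both.
  go : ∀ l → ∣ replicate l inside ++ layers k I ∣ ≡ l + ∣ I ∣ * k
  go zero    = ∣layers∣ k I
  go (suc l) = cong suc (go l)
∣layers∣ k (outside ∷ I) = go k
  where
  go : ∀ l → ∣ replicate l outside ++ layers k I ∣ ≡ ∣ I ∣ * k
  go zero    = ∣layers∣ k I
  go (suc l) = go l

module _ (G : Graph (Fin m)) (H : Graph (Fin n)) where

  ~□⁺ : ∀ {x i y j} → _~_ (cartesianProduct G H) (x , i) (y , j) →
    _~_ (G □ H) (combine x i) (combine y j)
  ~□⁺ {x} {i} {y} {j} = subst₂ (_~_ (cartesianProduct G H))
    (sym (remQuot-combine x i)) (sym (remQuot-combine y j))

  ~□⁻ : ∀ {x i y j} → _~_ (G □ H) (combine x i) (combine y j) →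
    _~_ (cartesianProduct G H) (x , i) (y , j)
  ~□⁻ {x} {i} {y} {j} = subst₂ (_~_ (cartesianProduct G H))
    (remQuot-combine x i) (remQuot-combine y j)

module _ (G : Graph (Fin m)) (H : Graph (Fin n)) (I : Subset m) where

  trace : Fin m → Subset m
  trace x = N[_] G x ∩ I

  trace□ : Fin m → Fin n → Subset (m * n)
  trace□ x i = N[_] (G □ H) (combine x i) ∩ layers n I

  ∈trace□⁺ : ∀ {x z} i → z ∈ trace x → combine z i ∈ trace□ x i
  ∈trace□⁺ {x} {z} i z∈ with x∈p∩q⁻ _ _ z∈
  ... | z∈N , z∈I = x∈p∩q⁺
    ( ∈N⁺ (G □ H) (adjacent (∈N⁻ G z∈N))
    , lookup⇒[]= _ _ (trans (lookup-layers I z i) ([]=⇒lookup z∈I)) )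
    where
    adjacent : x ≡ z ⊎ _~_ G x z →
      combine x i ≡ combine z i ⊎ _~_ (G □ H) (combine x i) (combine z i)
    adjacent (inj₁ refl) = inj₁ refl
    adjacent (inj₂ x~z) = inj₂ (~□⁺ G H (inj₂ (x~z , refl)))

  -- Equality and an `H`-edge both fix the first coordinate, so they merge into the case `x ≡ z`;
  -- only a `G`-edge ties the two layers together.
  ∈trace□⁻ : ∀ {x i} z j → combine z j ∈ trace□ x i →
    z ∈ I × (x ≡ z ⊎ _~_ G x z × i ≡ j)
  ∈trace□⁻ {x} {i} z j v∈ with x∈p∩q⁻ _ _ v∈
  ... | v∈N , v∈I =
    lookup⇒[]= _ _ (trans (sym (lookup-layers I z j)) ([]=⇒lookup v∈I)) ,
    adjacent (∈N⁻ (G □ H) v∈N)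
    where
    adjacent : combine x i ≡ combine z j ⊎ _~_ (G □ H) (combine x i) (combine z j) →
      x ≡ z ⊎ _~_ G x z × i ≡ j
    adjacent (inj₁ eq) = inj₁ (combine-injectiveˡ x i z j eq)
    adjacent (inj₂ a) with ~□⁻ G H a
    ... | inj₁ (x≡z , _) = inj₁ x≡z
    ... | inj₂ p         = inj₂ p

  sameLayer-⊆ : ∀ {x y i} → trace□ x i ≡ trace□ y i → trace x ⊆ trace y
  sameLayer-⊆ {i = i} eq {z} z∈
    with ∈trace□⁻ z i (subst (combine z i ∈_) eq (∈trace□⁺ i z∈))
  ... | z∈I , inj₁ y≡z       = x∈p∩q⁺ (∈N⁺ G (inj₁ y≡z) , z∈I)
  ... | z∈I , inj₂ (y~z , _) = x∈p∩q⁺ (∈N⁺ G (inj₂ y~z) , z∈I)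

  -- The copy of `z` in layer `i` must also be seen from layer `j`. A `G`-edge would give `j ≡ i`,
  -- so `z` can only be `y`.
  otherLayer-⊆ : ∀ {x y i j} → i ≢ j → trace□ x i ≡ trace□ y j →
    ∀ {z} → z ∈ trace x → y ≡ z × z ∈ I
  otherLayer-⊆ {i = i} i≢j eq {z} z∈
    with ∈trace□⁻ z i (subst (combine z i ∈_) eq (∈trace□⁺ i z∈))
  ... | z∈I , inj₁ y≡z       = y≡z , z∈I
  ... | z∈I , inj₂ (_ , j≡i) = contradiction (sym j≡i) i≢j

  module _ (idI : IsIDCode G I) (noIso : NoIsolatedVertices (G [ I ])) where

    layers-dominating : IsDominating (G □ H) (layers n I)
    layers-dominating v with combine-surjective {m} {n} v
    ... | x , i , refl with proj₁ idI x
    ...   | z , z∈ = combine z i , ∈trace□⁺ i z∈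

    layers-separating : ∀ x i y j → trace□ x i ≡ trace□ y j →
      combine x i ≡ combine y j
    layers-separating x i y j eq with i ≟ j
    ... | yes refl = cong (λ z → combine z i) (decidable-stable (x ≟ y) λ x≢y →
      proj₂ idI x y x≢y (⊆-antisym (sameLayer-⊆ eq) (sameLayer-⊆ (sym eq))))
    -- Domination makes the trace of `x` nonempty; its element must be `y`, which puts `y` in `I`.
    ... | no i≢j with proj₁ idI x
    ...   | z , z∈ with otherLayer-⊆ i≢j eq z∈
    ...     | refl , y∈I
      -- Now `y` lies in its own trace, and the same argument with the roles exchanged gives
      -- `x ≡ y`.
      with otherLayer-⊆ (λ j≡i → i≢j (sym j≡i)) (sym eq) (x∈p∩q⁺ (∈N⁺ G (inj₁ refl) , y∈I))
    ...       | refl , _ = contradiction isolated (noIso (x , y∈I))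
      where
      isolated : Isolated (G [ I ]) (x , y∈I)
      isolated (w , w∈I) x~w =
        -- A neighbour `w` in `I` would lie in the trace of `x`, hence equal `x` and yield a loop.
        ~-irr G (proj₁ (otherLayer-⊆ i≢j eq (x∈p∩q⁺ (∈N⁺ G (inj₂ x~w) , w∈I)))) x~w

    layers-isIDCode : IsIDCode (G □ H) (layers n I)
    layers-isIDCode = layers-dominating , separating
      where
      separating : ∀ u v → u ≢ v →
        N[_] (G □ H) u ∩ layers n I ≢ N[_] (G □ H) v ∩ layers n I
      separating u v u≢v eq
        with x , i , refl ← combine-surjective {m} {n} u
           | y , j , refl ← combine-surjective {m} {n} v
        = u≢v (layers-separating x i y j eq)

theorem8 : ∀ {n : ℕ} (G : Graph (Fin n)) (γ : ℕ) → γID≡ G γ →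
    (∃ λ (I : Subset n) → IsIDCode G I × ∣ I ∣ ≡ γ × NoIsolatedVertices (G [ I ])) →
    ∃ λ (γ′ : ℕ) → γID≡ (G □ K 2) γ′ × γ′ ≤ 2 * γ
theorem8 G _ _ (I , idI , refl , noIso)
  with γID-exists (G □ K 2) (layers 2 I) (layers-isIDCode G (K 2) I idI noIso)
... | γ′ , γ′-min , γ′≤ =
  γ′ , γ′-min , ≤-trans γ′≤ (≤-reflexive (trans (∣layers∣ 2 I) (*-comm ∣ I ∣ 2)))
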